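{- Let $D=(E,\mathcal F)$ be a vf-safe delta-matroid, let $\sigma\in\{\ast\times,\times\ast\}$, and let $S\subseteq E$. Then there exists $A\subseteq S$, together with an ordering $e_1,\ldots,e_k$ of the elements of $A$, such that $$\omega(D^{\sigma|A})=\max_{B\subseteq S}\omega(D^{\sigma|B}),$$ and the sequence $$\omega(D),\ \omega(D^{\sigma|\{e_1\}}),\ \omega(D^{\sigma|\{e_1,e_2\}}),\ \ldots,\ \omega(D^{\sigma|A})$$ is non-decreasing.
   Context: A set system is a pair $D=(E,\mathcal F)$ with $E$ a finite set and $\mathcal F\subseteq 2^E$; the members of $\mathcal F$ are the feasible sets. $D$ is proper if $\mathcal F\neq\emptyset$. A delta-matroid is a proper set system such that for all $X,Y\in\mathcal F$ and every $u\in X\triangle Y$ there exists $v\in X\triangle Y$ (possibly $v=u$) with $X\triangle\{u,v\}\in\mathcal F$, where $\triangle$ is symmetric difference. For proper $D$, $r(D_{\max})$ and $r(D_{\min})$ denote the largest and smallest cardinality of a feasible set, and the width is $\omega(D)=r(D_{\max})-r(D_{\min})$. Twist: for $A\subseteq E$, $D^{\ast|A}=(E,\{F\triangle A\mid F\in\mathcal F\})$. Loop complementation: for $e\in E$, $D^{\times|e}=(E,\mathcal F')$ with $\mathcal F'=\mathcal F\,\triangle\,\{F\cup\{e\}\mid F\in\mathcal F,\ e\notin F\}$. Loop complementations on distinct elements commute, and for $A\subseteq E$, $D^{\times|A}$ is obtained by applying loop complementation to every element of $A$. These operations preserve properness. Words are read left to right: $D^{\ast\times|A}=(D^{\ast|A})^{\times|A}$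 and $D^{\times\ast|A}=(D^{\times|A})^{\ast|A}$; also $D^{\sigma|\emptyset}=D$. A delta-matroid $D$ is vf-safe if every set system obtained from $D$ by an arbitrary finite sequence of twists and loop complementations (on elements or subsets of $E$) is again a delta-matroid. -}

module Defs where

open import Data.Bool using (Bool; _xor_; T)
import Data.Bool.Properties as Bool
open import Data.Fin using (Fin)
open import Data.Fin.Subset using (Subset; _∈_; _∪_; ⋃; ⁅_⁆; ∣_∣)
open import Data.Fin.Subset.Properties using (_∈?_; anySubset?)
open import Data.List using (List; _∷_; allFin; drop; filter; foldl; inits; map; upTo)
import Data.List.Membership.Propositional as List
open import Data.List.Extrema.Nat using (max; min)
open import Data.List.Relation.Unary.Unique.Propositional using (Unique)
open import Data.Nat using (ℕ; suc; _∸_)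
import Data.Nat.Properties as ℕ
open import Data.Product using (∃; _×_)
open import Data.Vec using (zipWith)
open import Data.Vec.Properties using (≡-dec)
open import Function using (_⇔_)
open import Relation.Binary.Definitions using (DecidableEquality)
open import Relation.Binary.PropositionalEquality using (_≡_)
open import Relation.Nullary using (Dec; does; ¬?)
open import Relation.Nullary.Decidable using (T?; _×-dec_)

private
  variable
    n : ℕ

infixl 6 _△_

_△_ : Subset n → Subset n → Subset n
p △ q = zipWith _xor_ p q

infix 4 _≟_

_≟_ : DecidableEquality (Subset n)
_≟_ = ≡-dec Bool._≟_

-- The ground set is Fin n.  A family of subsets is given by its (Boolean)
-- indicator function, so membership in it is decidable.
record SetSystem (n : ℕ) : Set where
  constructor setSystem
  field
    family : Subset n → Bool

  Feasible : Subset n → Set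
  Feasible X = T (family X)

  feasible? : ∀ X → Dec (Feasible X)
  feasible? X = T? (family X)

open SetSystem public

Proper : SetSystem n → Set
Proper D = ∃ λ X → Feasible D X

record IsDeltaMatroid (D : SetSystem n) : Set where
  field
    proper   : Proper D
    exchange : ∀ {X Y} → Feasible D X → Feasible D Y →
               ∀ {u} → u ∈ X △ Y →
               ∃ λ v → v ∈ X △ Y × Feasible D (X △ (⁅ u ⁆ ∪ ⁅ v ⁆))

feasibleSizes : SetSystem n → List ℕ
feasibleSizes {n} D =
  filter (λ k → anySubset? λ F → feasible? D F ×-dec ∣ F ∣ ℕ.≟ k) (upTo (suc n))

-- The default values 0 and n bound every cardinality, so they only matter
-- when D is not proper.
rmax rmin : SetSystem n → ℕ
rmax D = max 0 (feasibleSizes D)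
rmin {n} D = min n (feasibleSizes D)

ω : SetSystem n → ℕ
ω D = rmax D ∸ rmin D

-- { F △ A ∣ F feasible }
twist : SetSystem n → Subset n → SetSystem n
twist D A = setSystem λ X →
  does (anySubset? λ F → feasible? D F ×-dec X ≟ F △ A)

-- The symmetric difference of the feasible sets with
-- { F ∪ {e} ∣ F feasible, e ∉ F }.
loopComplement₁ : SetSystem n → Fin n → SetSystem n
loopComplement₁ D e = setSystem λ X →
  family D X xor
  does (anySubset? λ F → feasible? D F ×-dec ¬? (e ∈? F) ×-dec X ≟ F ∪ ⁅ e ⁆)

-- The elements of A are processed in increasing order; the result does not
-- depend on this choice, since loop complementations commute.
loopComplement : SetSystem n → Subset n → SetSystem n
loopComplement {n} D A = foldl loopComplement₁ D (filter (_∈? A) (allFin n))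

-- Operations on single elements are the case of singleton subsets.
data Operation (n : ℕ) : Set where
  twistOn loopComplementOn : Subset n → Operation n

apply : SetSystem n → Operation n → SetSystem n
apply D (twistOn A)          = twist D A
apply D (loopComplementOn A) = loopComplement D A

VfSafe : SetSystem n → Set
VfSafe {n} D = ∀ (ops : List (Operation n)) → IsDeltaMatroid (foldl apply D ops)

-- Words are read left to right: the leftmost operation is applied first.
data Word : Set where
  ∗× ×∗ : Word

infixl 8 _^[_∣_]

_^[_∣_] : SetSystem n → Word → Subset n → SetSystem n
D ^[ ∗× ∣ A ] = loopComplement (twist D A) A
D ^[ ×∗ ∣ A ] = twist (loopComplement D A) A

record _IsOrderingOf_ (es : List (Fin n)) (A : Subset n) : Set where
  field
    distinct : Unique es
    elements : ∀ e → e List.∈ es ⇔ e ∈ A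

fromList : List (Fin n) → Subset n
fromList es = ⋃ (map ⁅_⁆ es)

-- For es = e₁ , … , eₖ this is the list
-- ω(D) , ω(D^{σ|{e₁}}) , … , ω(D^{σ|{e₁,…,eₖ}});
-- its first entry stands for the empty prefix.
prefixWidths : SetSystem n → Word → List (Fin n) → List ℕ
prefixWidths D σ es =
  ω D ∷ map (λ p → ω (D ^[ σ ∣ fromList p ])) (drop 1 (inits es))

{-# OPTIONS --safe #-}

-- If the operation on a single element e strictly decreases the width, then
-- r(D_min) does not drop and r(D_max) does not rise, because r(D_min) rises and
-- r(D_max) falls by at most one.  This forces the smallest feasible sets to avoid
-- e and the largest ones to contain e.  Suppose that this holds for every e ∈ A.
-- A set feasible in D^{σ|A} agrees outside A with some Z feasible in D, and Z
-- contains a smallest and is contained in a largest feasible set of D, so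
-- ω(D^{σ|A}) ≤ ω(D).  Hence, starting from ∅ and moving inside a subset A of S of
-- maximal width by elements that do not decrease the width, one gets stuck only
-- at a subset whose width is already maximal.
module Submission where

open import Defs
open import Algebra.Bundles using (CommutativeRing)
open import Data.Bool using (Bool; true; false; _∧_; _xor_; not; T)
import Data.Bool.Properties as Bool
open import Data.Empty using (⊥-elim)
open import Data.Fin using (Fin; zero; suc)
import Data.Fin.Properties as Fin
open import Data.Fin.Subset
  using (Subset; _∈_; _∉_; _⊆_; _∪_; _-_; ⊥; ⊤; ∁; ⁅_⁆; ∣_∣)
open import Data.Fin.Subset.Properties
open import Data.List using (List; []; _∷_; allFin; drop; filter; foldl; inits; map; upTo)
import Data.List.Membership.Propositional as List
open import Data.List.Membership.Propositional.Properties
  using (∈-filter⁺; ∈-filter⁻; ∈-upTo⁺)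
open import Data.List.Extrema.Nat using (argmin-sel; max; min; min≤xs; v≤min⁺; max≤v⁺; xs≤max)
open import Data.List.Properties using (filter-≐; map-∘; map-tabulate)
import Data.List.Relation.Unary.All as All
open import Data.List.Relation.Unary.AllPairs using ([]; _∷_)
open import Data.List.Relation.Unary.Any using (here; there)
open import Data.List.Relation.Unary.Linked using (Linked; [-]; _∷_)
open import Data.List.Relation.Unary.Unique.Propositional using (Unique)
open import Data.Nat using (ℕ; zero; suc; _∸_; _≤_; _<_; _≤?_; z≤n; s≤s)
import Data.Nat.Properties as ℕ
open import Data.Product using (∃; _×_; _,_; proj₁; proj₂)
open import Data.Sum using (_⊎_; inj₁; inj₂)
open import Data.Vec using ([]; _∷_; lookup; here; there)
open import Data.Vec.Properties
  using (lookup⇒[]=; []=⇒lookup; lookup-zipWith; zipWith-assoc; zipWith-comm;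
         zipWith-identityʳ)
open import Function using (_∘_; id; mk⇔; Equivalence)
open import Relation.Binary.PropositionalEquality
  using (_≡_; _≢_; _≗_; refl; sym; trans; cong; cong₂; subst; module ≡-Reasoning)
open import Relation.Nullary using (¬_; Dec; yes; no; does; ¬?; contradiction)
open import Relation.Nullary.Decidable using (T?; _×-dec_; does-⇔)

private
  variable
    n : ℕ

-- Symmetric differences of subsets and their cardinalities

Disjoint : Subset n → Subset n → Set
Disjoint A B = ∀ {i} → i ∈ A → i ∉ B

drop-∷-Disjoint : ∀ {a b} {A B : Subset n} → Disjoint (a ∷ A) (b ∷ B) → Disjoint A B
drop-∷-Disjoint A∥B i∈A i∈B = A∥B (there i∈A) (there i∈B)

△-assoc : (X Y Z : Subset n) → (X △ Y) △ Z ≡ X △ (Y △ Z)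
△-assoc = zipWith-assoc Bool.xor-assoc

△-comm : (X Y : Subset n) → X △ Y ≡ Y △ X
△-comm = zipWith-comm Bool.xor-comm

△-identityʳ : (X : Subset n) → X △ ⊥ ≡ X
△-identityʳ = zipWith-identityʳ Bool.xor-identityʳ

△-cancelʳ : (X Y : Subset n) → (X △ Y) △ Y ≡ X
△-cancelʳ []      []      = refl
△-cancelʳ (x ∷ X) (y ∷ Y) = cong₂ _∷_ (cancel x y) (△-cancelʳ X Y)
  where
  cancel : ∀ x y → (x xor y) xor y ≡ x
  cancel x y = trans (Bool.xor-assoc x y y)
    (trans (cong (x xor_) (Bool.xor-same y)) (Bool.xor-identityʳ x))

△-⊤ : (X : Subset n) → X △ ⊤ ≡ ∁ X
△-⊤ []          = refl
△-⊤ (false ∷ X) = cong (true ∷_) (△-⊤ X)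
△-⊤ (true  ∷ X) = cong (false ∷_) (△-⊤ X)

∁-involutive : (X : Subset n) → ∁ (∁ X) ≡ X
∁-involutive []      = refl
∁-involutive (x ∷ X) = cong₂ _∷_ (Bool.not-involutive x) (∁-involutive X)

disjoint⇒△≡∪ : {A B : Subset n} → Disjoint A B → A △ B ≡ A ∪ B
disjoint⇒△≡∪ {A = []}        {[]}        A∥B = refl
disjoint⇒△≡∪ {A = false ∷ A} {b     ∷ B} A∥B = cong (b ∷_) (disjoint⇒△≡∪ (drop-∷-Disjoint A∥B))
disjoint⇒△≡∪ {A = true  ∷ A} {false ∷ B} A∥B = cong (true ∷_) (disjoint⇒△≡∪ (drop-∷-Disjoint A∥B))
disjoint⇒△≡∪ {A = true  ∷ A} {true  ∷ B} A∥B = ⊥-elim (A∥B here here)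

△-∪ : ∀ {A B : Subset n} → Disjoint A B → ∀ X → X △ B △ A ≡ X △ (A ∪ B)
△-∪ {A = A} {B} A∥B X = trans (△-assoc X B A)
  (cong (X △_) (trans (△-comm B A) (disjoint⇒△≡∪ A∥B)))

∉⇒lookup : ∀ {i} {X : Subset n} → i ∉ X → lookup X i ≡ false
∉⇒lookup {i = i} {X} i∉X = Bool.¬-not (i∉X ∘ lookup⇒[]= i X)

lookup-△ : ∀ (X Y : Subset n) i → lookup (X △ Y) i ≡ lookup X i xor lookup Y i
lookup-△ X Y i = lookup-zipWith _xor_ i X Y

lookup-△-∉ : ∀ (X : Subset n) {Y i} → i ∉ Y → lookup (X △ Y) i ≡ lookup X i
lookup-△-∉ X {Y} {i} i∉Y = trans (lookup-△ X Y i)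
  (trans (cong (lookup X i xor_) (∉⇒lookup i∉Y)) (Bool.xor-identityʳ _))

lookup-△-⁅⁆ : ∀ (X : Subset n) e → lookup (X △ ⁅ e ⁆) e ≡ not (lookup X e)
lookup-△-⁅⁆ X e = trans (lookup-△ X ⁅ e ⁆ e)
  (trans (cong (lookup X e xor_) ([]=⇒lookup (x∈⁅x⁆ e))) (xor-true (lookup X e)))
  where
  xor-true : ∀ b → b xor true ≡ not b
  xor-true false = refl
  xor-true true  = refl

x∈p∧x∉q⇒x∈p△q : ∀ {i} {X Y : Subset n} → i ∈ X → i ∉ Y → i ∈ X △ Y
x∈p∧x∉q⇒x∈p△q {i = i} {X} {Y} i∈X i∉Y =
  lookup⇒[]= i (X △ Y) (trans (lookup-△-∉ X i∉Y) ([]=⇒lookup i∈X))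

x∉p∧x∉q⇒x∉p△q : ∀ {i} {X Y : Subset n} → i ∉ X → i ∉ Y → i ∉ X △ Y
x∉p∧x∉q⇒x∉p△q {i = i} {X} {Y} i∉X i∉Y i∈X△Y =
  i∉X (lookup⇒[]= i X (trans (sym (lookup-△-∉ X i∉Y)) ([]=⇒lookup i∈X△Y)))

∣p△⁅x⁆∣-∈ : ∀ {e} {X : Subset n} → e ∈ X → suc ∣ X △ ⁅ e ⁆ ∣ ≡ ∣ X ∣
∣p△⁅x⁆∣-∈ {e = zero}  {true  ∷ X} here        = cong (suc ∘ ∣_∣) (△-identityʳ X)
∣p△⁅x⁆∣-∈ {e = suc e} {false ∷ X} (there e∈X) = ∣p△⁅x⁆∣-∈ e∈X
∣p△⁅x⁆∣-∈ {e = suc e} {true  ∷ X} (there e∈X) = cong suc (∣p△⁅x⁆∣-∈ e∈X)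

∣p△⁅x⁆∣-∉ : ∀ {e} {X : Subset n} → e ∉ X → ∣ X △ ⁅ e ⁆ ∣ ≡ suc ∣ X ∣
∣p△⁅x⁆∣-∉ {e = e} {X} e∉X = sym (trans
  (cong (suc ∘ ∣_∣) (sym (△-cancelʳ X ⁅ e ⁆)))
  (∣p△⁅x⁆∣-∈ (lookup⇒[]= e (X △ ⁅ e ⁆) (trans (lookup-△-⁅⁆ X e) (cong not (∉⇒lookup e∉X))))))

∣p△⁅x⁆∣≤ : ∀ e (X : Subset n) → ∣ X △ ⁅ e ⁆ ∣ ≤ suc ∣ X ∣
∣p△⁅x⁆∣≤ e X with e ∈? X
... | yes e∈X = ℕ.m≤n⇒m≤1+n (ℕ.≤-trans (ℕ.n≤1+n _) (ℕ.≤-reflexive (∣p△⁅x⁆∣-∈ e∈X)))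
... | no  e∉X = ℕ.≤-reflexive (∣p△⁅x⁆∣-∉ e∉X)

∣p∣≤∣p△⁅x⁆∣ : ∀ e (X : Subset n) → ∣ X ∣ ≤ suc ∣ X △ ⁅ e ⁆ ∣
∣p∣≤∣p△⁅x⁆∣ e X = subst (λ Y → ∣ Y ∣ ≤ suc ∣ X △ ⁅ e ⁆ ∣) (△-cancelʳ X ⁅ e ⁆)
  (∣p△⁅x⁆∣≤ e (X △ ⁅ e ⁆))

⁅x⁆∪[p-x]≡p : ∀ {e} {A : Subset n} → e ∈ A → ⁅ e ⁆ ∪ (A - e) ≡ A
⁅x⁆∪[p-x]≡p {e = e} {A} e∈A = ⊆-antisym to from
  where
  to : ⁅ e ⁆ ∪ (A - e) ⊆ A
  to i∈ with x∈p∪q⁻ ⁅ e ⁆ (A - e) i∈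
  ... | inj₁ i∈⁅e⁆ = subst (_∈ A) (sym (x∈⁅y⁆⇒x≡y e i∈⁅e⁆)) e∈A
  ... | inj₂ i∈A-e = p─q⊆p A ⁅ e ⁆ i∈A-e
  from : A ⊆ ⁅ e ⁆ ∪ (A - e)
  from {i} i∈A with i Fin.≟ e
  ... | yes refl = x∈p∪q⁺ (inj₁ (x∈⁅x⁆ e))
  ... | no i≢e   = x∈p∪q⁺ (inj₂ (x∈p∧x≢y⇒x∈p-y i∈A i≢e))

x∉p⇒⁅x⁆-disjoint : ∀ {e} {A : Subset n} → e ∉ A → Disjoint ⁅ e ⁆ A
x∉p⇒⁅x⁆-disjoint {e = e} {A} e∉A i∈⁅e⁆ i∈A = e∉A (subst (_∈ A) (x∈⁅y⁆⇒x≡y e i∈⁅e⁆) i∈A)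

-- Splits an exchange at two distinct elements into single flips, whose effect on cardinality is
-- known.
p△⁅x,y⁆≡p△⁅x⁆△⁅y⁆ : ∀ (X : Subset n) {u v} → v ≢ u → X △ (⁅ u ⁆ ∪ ⁅ v ⁆) ≡ X △ ⁅ u ⁆ △ ⁅ v ⁆
p△⁅x,y⁆≡p△⁅x⁆△⁅y⁆ X {u} {v} v≢u = trans
  (cong (X △_) (sym (disjoint⇒△≡∪ (x∉p⇒⁅x⁆-disjoint (x≢y⇒x∉⁅y⁆ (v≢u ∘ sym))))))
  (sym (△-assoc X ⁅ u ⁆ ⁅ v ⁆))

x∉p-x : ∀ e (A : Subset n) → e ∉ A - e
x∉p-x zero    (a ∷ A) ()
x∉p-x (suc e) (a ∷ A) (there e∈) = x∉p-x e A e∈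

argmaxSubset : (g : Subset n → ℕ) (S : Subset n) →
  ∃ λ A → A ⊆ S × (∀ B → B ⊆ S → g B ≤ g A)
argmaxSubset g [] = [] , id , λ { [] _ → ℕ.≤-refl }
argmaxSubset g (false ∷ S) with argmaxSubset (g ∘ (false ∷_)) S
... | A , A⊆S , A-max = false ∷ A , out⊆ A⊆S , λ
  { (false ∷ B) B⊆S → A-max B (drop-∷-⊆ B⊆S)
  ; (true  ∷ B) B⊆S → contradiction (B⊆S here) λ () }
argmaxSubset g (true ∷ S)
  with argmaxSubset (g ∘ (false ∷_)) S | argmaxSubset (g ∘ (true ∷_)) S
... | A , A⊆S , A-max | A′ , A′⊆S , A′-max
  with ℕ.≤-total (g (false ∷ A)) (g (true ∷ A′))
... | inj₁ A≤A′ = true ∷ A′ , s⊆s A′⊆S , λ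
  { (false ∷ B) B⊆S → ℕ.≤-trans (A-max B (drop-∷-⊆ B⊆S)) A≤A′
  ; (true  ∷ B) B⊆S → A′-max B (drop-∷-⊆ B⊆S) }
... | inj₂ A′≤A = false ∷ A , out⊆ A⊆S , λ
  { (false ∷ B) B⊆S → A-max B (drop-∷-⊆ B⊆S)
  ; (true  ∷ B) B⊆S → ℕ.≤-trans (A′-max B (drop-∷-⊆ B⊆S)) A′≤A }

-- Sizes of feasible sets

infix 4 _≈_

_≈_ : SetSystem n → SetSystem n → Set
D ≈ D′ = family D ≗ family D′

HasSize : SetSystem n → ℕ → Set
HasSize D k = ∃ λ F → Feasible D F × ∣ F ∣ ≡ k

hasSize? : ∀ (D : SetSystem n) k → Dec (HasSize D k)
hasSize? D k = anySubset? λ F → feasible? D F ×-dec ∣ F ∣ ℕ.≟ k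

ω-cong : {D D′ : SetSystem n} → D ≈ D′ → ω D ≡ ω D′
ω-cong {n} {D} {D′} D≈D′ = cong (λ ks → max 0 ks ∸ min n ks)
  (filter-≐ (hasSize? D) (hasSize? D′)
    (hasSize-resp D≈D′ , hasSize-resp (sym ∘ D≈D′)) (upTo (suc n)))
  where
  hasSize-resp : {D D′ : SetSystem n} → D ≈ D′ → ∀ {k} → HasSize D k → HasSize D′ k
  hasSize-resp D≈D′ (F , F∈D , ∣F∣≡k) = F , subst T (D≈D′ F) F∈D , ∣F∣≡k

module _ (D : SetSystem n) where

  private
    sizes⁺ : ∀ {F} → Feasible D F → ∣ F ∣ List.∈ feasibleSizes D
    sizes⁺ {F} F∈D = ∈-filter⁺ (hasSize? D) (∈-upTo⁺ (s≤s (∣p∣≤n F))) (F , F∈D , refl)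

    sizes⁻ : ∀ {k} → k List.∈ feasibleSizes D → HasSize D k
    sizes⁻ k∈ = proj₂ (∈-filter⁻ (hasSize? D) {xs = upTo (suc n)} k∈)

  ≤rmax : ∀ {F} → Feasible D F → ∣ F ∣ ≤ rmax D
  ≤rmax F∈D = All.lookup (xs≤max 0 (feasibleSizes D)) (sizes⁺ F∈D)

  rmin≤ : ∀ {F} → Feasible D F → rmin D ≤ ∣ F ∣
  rmin≤ F∈D = All.lookup (min≤xs n (feasibleSizes D)) (sizes⁺ F∈D)

  rmax≤ : ∀ {k} → (∀ F → Feasible D F → ∣ F ∣ ≤ k) → rmax D ≤ k
  rmax≤ bound = max≤v⁺ z≤n (All.tabulate λ k∈ → bounded (sizes⁻ k∈))
    where
    bounded : ∀ {k} → HasSize D k → k ≤ _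
    bounded (F , F∈D , refl) = bound F F∈D

  -- The hypothesis `k ≤ n` accounts for the default value `n` of the minimum; for `rmax≤` the
  -- default is 0.
  ≤rmin : ∀ {k} → k ≤ n → (∀ F → Feasible D F → k ≤ ∣ F ∣) → k ≤ rmin D
  ≤rmin k≤n bound = v≤min⁺ k≤n (All.tabulate λ k∈ → bounded (sizes⁻ k∈))
    where
    bounded : ∀ {k} → HasSize D k → _ ≤ k
    bounded (F , F∈D , refl) = bound F F∈D

  rmin-attained : Proper D → ∃ λ F → Feasible D F × ∣ F ∣ ≡ rmin D
  rmin-attained (F , F∈D) with argmin-sel id n (feasibleSizes D)
  -- Here the minimum is the default `n`. No subset has more than `n` elements, so any feasible set
  -- attains it.
  ... | inj₁ rmin≡n = F , F∈D ,
    ℕ.≤-antisym (subst (∣ F ∣ ≤_) (sym rmin≡n) (∣p∣≤n F)) (rmin≤ F∈D)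
  ... | inj₂ rmin∈ = sizes⁻ rmin∈

-- Delta-matroids

module _ {D : SetSystem n} (Δ : IsDeltaMatroid D) where

  open IsDeltaMatroid Δ

  -- Exchanging u ∈ F₀ outside F cannot shrink a smallest feasible set F₀, so it
  -- brings in an element of F and moves F₀ closer to F.
  contains-smallest : ∀ {F} → Feasible D F →
    ∃ λ F₀ → Feasible D F₀ × ∣ F₀ ∣ ≡ rmin D × F₀ ⊆ F
  contains-smallest {F} F∈D with rmin-attained D proper
  ... | F₀ , F₀∈D , ∣F₀∣≡rmin = improve _ F₀ F₀∈D ∣F₀∣≡rmin (ℕ.n<1+n _)
    where
    improve : ∀ k F₀ → Feasible D F₀ → ∣ F₀ ∣ ≡ rmin D → ∣ F₀ △ F ∣ < k →
      ∃ λ F₀ → Feasible D F₀ × ∣ F₀ ∣ ≡ rmin D × F₀ ⊆ F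
    improve (suc k) F₀ F₀∈D ∣F₀∣≡rmin (s≤s d≤k)
      with Fin.any? (λ u → (u ∈? F₀) ×-dec ¬? (u ∈? F))
    ... | no ∄u = F₀ , F₀∈D , ∣F₀∣≡rmin , F₀⊆F
      where
      F₀⊆F : F₀ ⊆ F
      F₀⊆F {u} u∈F₀ with u ∈? F
      ... | yes u∈F = u∈F
      ... | no  u∉F = contradiction (u , u∈F₀ , u∉F) ∄u
    ... | yes (u , u∈F₀ , u∉F) with x∈p∧x∉q⇒x∈p△q u∈F₀ u∉F
    ... | u∈F₀△F with exchange F₀∈D F∈D u∈F₀△F
    ... | v , v∈F₀△F , F₁∈D with v Fin.≟ u
    ... | yes refl = contradiction (rmin≤ D F₁∈D) (ℕ.<⇒≱ (begin-strict
      ∣ F₀ △ (⁅ u ⁆ ∪ ⁅ u ⁆) ∣ ≡⟨ cong (λ Z → ∣ F₀ △ Z ∣) (∪-idem ⁅ u ⁆) ⟩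
      ∣ F₀ △ ⁅ u ⁆ ∣           <⟨ ℕ.≤-reflexive (∣p△⁅x⁆∣-∈ u∈F₀) ⟩
      ∣ F₀ ∣                   ≡⟨ ∣F₀∣≡rmin ⟩
      rmin D                   ∎))
      where open ℕ.≤-Reasoning
    ... | no v≢u with v ∈? F₀
    ...   | yes v∈F₀ = contradiction (rmin≤ D F₁∈D) (ℕ.<⇒≱ (begin-strict
      ∣ F₀ △ (⁅ u ⁆ ∪ ⁅ v ⁆) ∣ ≡⟨ cong ∣_∣ (p△⁅x,y⁆≡p△⁅x⁆△⁅y⁆ F₀ v≢u) ⟩
      ∣ F₀ △ ⁅ u ⁆ △ ⁅ v ⁆ ∣   <⟨ ℕ.≤-reflexive (∣p△⁅x⁆∣-∈ (x∈p∧x∉q⇒x∈p△q v∈F₀ (x≢y⇒x∉⁅y⁆ v≢u))) ⟩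
      ∣ F₀ △ ⁅ u ⁆ ∣           <⟨ ℕ.≤-reflexive (∣p△⁅x⁆∣-∈ u∈F₀) ⟩
      ∣ F₀ ∣                   ≡⟨ ∣F₀∣≡rmin ⟩
      rmin D                   ∎))
      where open ℕ.≤-Reasoning
    ...   | no v∉F₀ = improve k F₁ F₁∈D ∣F₁∣≡rmin (ℕ.<-≤-trans closer d≤k)
      where
      F₁ = F₀ △ (⁅ u ⁆ ∪ ⁅ v ⁆)
      v∉⁅u⁆ = x≢y⇒x∉⁅y⁆ v≢u
      F₁≡ = p△⁅x,y⁆≡p△⁅x⁆△⁅y⁆ F₀ v≢u
      ∣F₁∣≡rmin : ∣ F₁ ∣ ≡ rmin D
      ∣F₁∣≡rmin = begin
        ∣ F₁ ∣                 ≡⟨ cong ∣_∣ F₁≡ ⟩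
        ∣ F₀ △ ⁅ u ⁆ △ ⁅ v ⁆ ∣ ≡⟨ ∣p△⁅x⁆∣-∉ (x∉p∧x∉q⇒x∉p△q v∉F₀ v∉⁅u⁆) ⟩
        suc ∣ F₀ △ ⁅ u ⁆ ∣     ≡⟨ ∣p△⁅x⁆∣-∈ u∈F₀ ⟩
        ∣ F₀ ∣                 ≡⟨ ∣F₀∣≡rmin ⟩
        rmin D                 ∎
        where open ≡-Reasoning
      F₁△F≡ : F₁ △ F ≡ F₀ △ F △ ⁅ u ⁆ △ ⁅ v ⁆
      F₁△F≡ = begin
        F₁ △ F                         ≡⟨ △-assoc F₀ _ F ⟩
        F₀ △ ((⁅ u ⁆ ∪ ⁅ v ⁆) △ F)     ≡⟨ cong (F₀ △_) (△-comm _ F) ⟩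
        F₀ △ (F △ (⁅ u ⁆ ∪ ⁅ v ⁆))     ≡⟨ △-assoc F₀ F _ ⟨
        F₀ △ F △ (⁅ u ⁆ ∪ ⁅ v ⁆)       ≡⟨ p△⁅x,y⁆≡p△⁅x⁆△⁅y⁆ (F₀ △ F) v≢u ⟩
        F₀ △ F △ ⁅ u ⁆ △ ⁅ v ⁆         ∎
        where open ≡-Reasoning
      closer : ∣ F₁ △ F ∣ < ∣ F₀ △ F ∣
      closer = begin-strict
        ∣ F₁ △ F ∣                 ≡⟨ cong ∣_∣ F₁△F≡ ⟩
        ∣ F₀ △ F △ ⁅ u ⁆ △ ⁅ v ⁆ ∣ <⟨ ℕ.≤-reflexive (∣p△⁅x⁆∣-∈ (x∈p∧x∉q⇒x∈p△q v∈F₀△F v∉⁅u⁆)) ⟩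
        ∣ F₀ △ F △ ⁅ u ⁆ ∣         <⟨ ℕ.≤-reflexive (∣p△⁅x⁆∣-∈ u∈F₀△F) ⟩
        ∣ F₀ △ F ∣                 ∎
        where open ℕ.≤-Reasoning

family-twist : ∀ (D : SetSystem n) A X → family (twist D A) X ≡ family D (X △ A)
family-twist D A X = does-⇔ (mk⇔ to from)
  (anySubset? λ F → feasible? D F ×-dec X ≟ F △ A) (T? (family D (X △ A)))
  where
  to : (∃ λ F → Feasible D F × X ≡ F △ A) → Feasible D (X △ A)
  to (F , F∈D , refl) = subst (Feasible D) (sym (△-cancelʳ F A)) F∈D
  from : Feasible D (X △ A) → ∃ λ F → Feasible D F × X ≡ F △ A
  from X△A∈D = X △ A , X△A∈D , sym (△-cancelʳ X A)

feasible-twist-⊤ : ∀ (D : SetSystem n) X → Feasible (twist D ⊤) X ≡ Feasible D (∁ X)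
feasible-twist-⊤ D X = cong T (trans (family-twist D ⊤ X) (cong (family D) (△-⊤ X)))

∁-feasible-twist-⊤ : ∀ (D : SetSystem n) {X} → Feasible D X → Feasible (twist D ⊤) (∁ X)
∁-feasible-twist-⊤ D {X} X∈D = subst id (sym (feasible-twist-⊤ D (∁ X)))
  (subst (Feasible D) (sym (∁-involutive X)) X∈D)

-- The dual of `contains-smallest`: twisting by `⊤` complements every feasible set, which reverses
-- inclusions and exchanges smallest with largest.
contained-in-largest : {D : SetSystem n} → IsDeltaMatroid (twist D ⊤) → ∀ {F} → Feasible D F →
  ∃ λ F₀ → Feasible D F₀ × ∣ F₀ ∣ ≡ rmax D × F ⊆ F₀
contained-in-largest {n} {D} Δ {F} F∈D with contains-smallest Δ (∁-feasible-twist-⊤ D F∈D)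
... | G , G∈D∁ , ∣G∣≡rmin , G⊆∁F = ∁ G , ∁G∈D ,
  ℕ.≤-antisym (≤rmax D ∁G∈D) (rmax≤ D largest) , F⊆∁G
  where
  ∁G∈D = subst id (feasible-twist-⊤ D G) G∈D∁
  F⊆∁G : F ⊆ ∁ G
  F⊆∁G i∈F = x∉p⇒x∈∁p λ i∈G → x∈∁p⇒x∉p (G⊆∁F i∈G) i∈F
  largest : ∀ X → Feasible D X → ∣ X ∣ ≤ ∣ ∁ G ∣
  largest X X∈D = begin
    ∣ X ∣                ≡⟨ cong ∣_∣ (∁-involutive X) ⟨
    ∣ ∁ (∁ X) ∣          ≡⟨ ∣∁p∣≡n∸∣p∣ (∁ X) ⟩
    n ∸ ∣ ∁ X ∣          ≤⟨ ℕ.∸-monoʳ-≤ n (rmin≤ (twist D ⊤) (∁-feasible-twist-⊤ D X∈D)) ⟩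
    n ∸ rmin (twist D ⊤) ≡⟨ cong (n ∸_) ∣G∣≡rmin ⟨
    n ∸ ∣ G ∣            ≡⟨ ∣∁p∣≡n∸∣p∣ G ⟨
    ∣ ∁ G ∣              ∎
    where open ℕ.≤-Reasoning

-- Loop complementation of indicator functions

-- This is the parity of the number of sets Y satisfying `f` that lie between X minus A and X.
-- Recursion over coordinates treats all of A at once and involves no order of its elements.
loop : (Subset n → Bool) → Subset n → Subset n → Bool
loop f []          []          = f []
loop f (false ∷ A) (x     ∷ X) = loop (f ∘ (x ∷_)) A X
loop f (true  ∷ A) (false ∷ X) = loop (f ∘ (false ∷_)) A X
loop f (true  ∷ A) (true  ∷ X) = loop (λ Y → f (true ∷ Y) xor f (false ∷ Y)) A X

loop-cong : {f g : Subset n → Bool} → f ≗ g → ∀ A → loop f A ≗ loop g A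
loop-cong f≗g []          []          = f≗g []
loop-cong f≗g (false ∷ A) (x     ∷ X) = loop-cong (f≗g ∘ (x ∷_)) A X
loop-cong f≗g (true  ∷ A) (false ∷ X) = loop-cong (f≗g ∘ (false ∷_)) A X
loop-cong f≗g (true  ∷ A) (true  ∷ X) =
  loop-cong (λ Y → cong₂ _xor_ (f≗g (true ∷ Y)) (f≗g (false ∷ Y))) A X

-- Linearity over the field with two elements. In `loop-∪` it merges the two inner values that are
-- summed at a coordinate lying in B only.
loop-xor : ∀ (f g : Subset n → Bool) A X →
  loop (λ Y → f Y xor g Y) A X ≡ loop f A X xor loop g A X
loop-xor f g []          []          = refl
loop-xor f g (false ∷ A) (x     ∷ X) = loop-xor (f ∘ (x ∷_)) (g ∘ (x ∷_)) A X
loop-xor f g (true  ∷ A) (false ∷ X) = loop-xor (f ∘ (false ∷_)) (g ∘ (false ∷_)) A X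
loop-xor f g (true  ∷ A) (true  ∷ X) = trans
  (loop-cong (λ Y → interchange (f (true ∷ Y)) (g (true ∷ Y)) (f (false ∷ Y)) (g (false ∷ Y))) A X)
  (loop-xor (λ Y → f (true ∷ Y) xor f (false ∷ Y)) (λ Y → g (true ∷ Y) xor g (false ∷ Y)) A X)
  where
  open CommutativeRing Bool.xor-∧-commutativeRing using (+-commutativeSemigroup)
  open import Algebra.Properties.CommutativeSemigroup +-commutativeSemigroup using (interchange)

loop-⊥ : ∀ (f : Subset n → Bool) → loop f ⊥ ≗ f
loop-⊥ f []      = refl
loop-⊥ f (x ∷ X) = loop-⊥ (f ∘ (x ∷_)) X

-- Disjointness excludes a common element, at which the two loop complementations would cancel.
loop-∪ : ∀ (f : Subset n → Bool) {A B} → Disjoint A B → loop (loop f A) B ≗ loop f (A ∪ B)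
loop-∪ f {[]}        {[]}        A∥B []          = refl
loop-∪ f {false ∷ A} {false ∷ B} A∥B (x     ∷ X) = loop-∪ (f ∘ (x ∷_)) (drop-∷-Disjoint A∥B) X
loop-∪ f {false ∷ A} {true  ∷ B} A∥B (false ∷ X) = loop-∪ (f ∘ (false ∷_)) (drop-∷-Disjoint A∥B) X
loop-∪ f {false ∷ A} {true  ∷ B} A∥B (true  ∷ X) = trans
  (loop-cong (λ Y → sym (loop-xor (f ∘ (true ∷_)) (f ∘ (false ∷_)) A Y)) B X)
  (loop-∪ _ (drop-∷-Disjoint A∥B) X)
loop-∪ f {true  ∷ A} {false ∷ B} A∥B (false ∷ X) = loop-∪ (f ∘ (false ∷_)) (drop-∷-Disjoint A∥B) X
loop-∪ f {true  ∷ A} {false ∷ B} A∥B (true  ∷ X) = loop-∪ _ (drop-∷-Disjoint A∥B) X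
loop-∪ f {true  ∷ A} {true  ∷ B} A∥B X           = ⊥-elim (A∥B here here)

-- Twists and loop complementations on disjoint sets act on different coordinates and therefore
-- commute.
loop-△ : ∀ (f : Subset n → Bool) {A B} → Disjoint A B → ∀ X →
  loop f A (X △ B) ≡ loop (λ Y → f (Y △ B)) A X
loop-△ f {[]}        {[]}        A∥B []          = refl
loop-△ f {false ∷ A} {b     ∷ B} A∥B (x     ∷ X) = loop-△ (f ∘ ((x xor b) ∷_)) (drop-∷-Disjoint A∥B) X
loop-△ f {true  ∷ A} {false ∷ B} A∥B (false ∷ X) = loop-△ (f ∘ (false ∷_)) (drop-∷-Disjoint A∥B) X
loop-△ f {true  ∷ A} {false ∷ B} A∥B (true  ∷ X) = loop-△ _ (drop-∷-Disjoint A∥B) X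
loop-△ f {true  ∷ A} {true  ∷ B} A∥B X           = ⊥-elim (A∥B here here)

-- A sum modulo two can be true only if one of its terms is, and every term is a value of `f` at a
-- set that differs from X only inside A.
loop-local : ∀ (f : Subset n → Bool) A X → T (loop f A X) →
  ∃ λ Y → T (f Y) × (∀ {i} → i ∉ A → lookup X i ≡ lookup Y i)
loop-local f [] [] t = [] , t , λ _ → refl
loop-local f (false ∷ A) (x ∷ X) t with loop-local (f ∘ (x ∷_)) A X t
... | Y , fY , X≡Y = x ∷ Y , fY , λ { {zero} _ → refl ; {suc i} i∉ → X≡Y (i∉ ∘ there) }
loop-local f (true ∷ A) (false ∷ X) t with loop-local (f ∘ (false ∷_)) A X t
... | Y , fY , X≡Y = false ∷ Y , fY , λ { {zero} _ → refl ; {suc i} i∉ → X≡Y (i∉ ∘ there) }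
loop-local f (true ∷ A) (true ∷ X) t
  with loop-local (λ Y → f (true ∷ Y) xor f (false ∷ Y)) A X t
... | Y , fY , X≡Y with T? (f (true ∷ Y)) | T? (f (false ∷ Y))
...   | yes ft | _      = true ∷ Y , ft , λ { {zero} _ → refl ; {suc i} i∉ → X≡Y (i∉ ∘ there) }
...   | no _   | yes ff = false ∷ Y , ff , λ
  { {zero} 0∉ → contradiction here 0∉
  ; {suc i} i∉ → X≡Y (i∉ ∘ there) }
...   | no ¬ft | no ¬ff = ⊥-elim (neither (f (true ∷ Y)) (f (false ∷ Y)) ¬ft ¬ff fY)
  where
  neither : ∀ a b → ¬ T a → ¬ T b → ¬ T (a xor b)
  neither true  b     ¬a ¬b _ = ¬a _
  neither false true  ¬a ¬b _ = ¬b _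

-- If X arises by adding e to a feasible set avoiding e, that set must be `X △ ⁅ e ⁆`, and e must
-- lie in X. This removes the search from `loopComplement₁`.
loop₁ : (Subset n → Bool) → Fin n → Subset n → Bool
loop₁ f e X = f X xor (lookup X e ∧ f (X △ ⁅ e ⁆))

loop-⁅⁆ : ∀ (f : Subset n → Bool) e → loop f ⁅ e ⁆ ≗ loop₁ f e
loop-⁅⁆ f zero    (false ∷ X) = trans (loop-⊥ (f ∘ (false ∷_)) X) (sym (Bool.xor-identityʳ _))
loop-⁅⁆ f zero    (true  ∷ X) = trans (loop-⊥ _ X)
  (cong (λ Y → f (true ∷ X) xor f (false ∷ Y)) (sym (△-identityʳ X)))
loop-⁅⁆ f (suc e) (false ∷ X) = loop-⁅⁆ (f ∘ (false ∷_)) e X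
loop-⁅⁆ f (suc e) (true  ∷ X) = loop-⁅⁆ (f ∘ (true ∷_)) e X

family-loopComplement₁ : ∀ (D : SetSystem n) e → family (loopComplement₁ D e) ≗ loop₁ (family D) e
family-loopComplement₁ D e X = cong (family D X xor_) (does-⇔ (mk⇔ to from)
  (anySubset? λ F → feasible? D F ×-dec ¬? (e ∈? F) ×-dec X ≟ F ∪ ⁅ e ⁆)
  (T? (lookup X e ∧ family D (X △ ⁅ e ⁆))))
  where
  Preimage : Set
  Preimage = ∃ λ F → Feasible D F × e ∉ F × X ≡ F ∪ ⁅ e ⁆
  ∪≡△ : ∀ {F} → e ∉ F → F ∪ ⁅ e ⁆ ≡ F △ ⁅ e ⁆
  ∪≡△ e∉F = sym (disjoint⇒△≡∪ λ i∈F i∈⁅e⁆ → x∉p⇒⁅x⁆-disjoint e∉F i∈⁅e⁆ i∈F)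
  to : Preimage → T (lookup X e ∧ family D (X △ ⁅ e ⁆))
  to (F , F∈D , e∉F , refl) = Equivalence.from Bool.T-∧
    ( Equivalence.from Bool.T-≡ ([]=⇒lookup (q⊆p∪q F ⁅ e ⁆ (x∈⁅x⁆ e)))
    , subst (Feasible D) (sym (trans (cong (_△ ⁅ e ⁆) (∪≡△ e∉F)) (△-cancelʳ F ⁅ e ⁆))) F∈D )
  from : T (lookup X e ∧ family D (X △ ⁅ e ⁆)) → Preimage
  from t with Equivalence.to Bool.T-∧ t
  ... | e∈X , X△e∈D = X △ ⁅ e ⁆ , X△e∈D , e∉X△e ,
    trans (sym (△-cancelʳ X ⁅ e ⁆)) (sym (∪≡△ e∉X△e))
    where
    e∉X△e : e ∉ X △ ⁅ e ⁆
    e∉X△e e∈ with trans (sym ([]=⇒lookup e∈))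
      (trans (lookup-△-⁅⁆ X e) (cong not (Equivalence.to Bool.T-≡ e∈X)))
    ... | ()

loop₁-cong : {f g : Subset n → Bool} → f ≗ g → ∀ e → loop₁ f e ≗ loop₁ g e
loop₁-cong f≗g e X = cong₂ (λ a b → a xor (lookup X e ∧ b)) (f≗g X) (f≗g (X △ ⁅ e ⁆))

family-foldl : ∀ {D D′ : SetSystem n} → D ≈ D′ → ∀ es →
  foldl loopComplement₁ D es ≈ foldl loopComplement₁ D′ es
family-foldl D≈D′ []       = D≈D′
family-foldl {D = D} {D′} D≈D′ (e ∷ es) = family-foldl (λ X → trans (family-loopComplement₁ D e X)
  (trans (loop₁-cong D≈D′ e X) (sym (family-loopComplement₁ D′ e X)))) es

-- Deletion of the first element for `false`, its contraction for `true`, without requiring the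
-- result to be proper.
slice : Bool → SetSystem (suc n) → SetSystem n
slice x D = setSystem (family D ∘ (x ∷_))

slice-foldl : ∀ x (D : SetSystem (suc n)) es →
  slice x (foldl loopComplement₁ D (map suc es)) ≈ foldl loopComplement₁ (slice x D) es
slice-foldl x D []       X = refl
slice-foldl x D (e ∷ es) X = trans (slice-foldl x (loopComplement₁ D (suc e)) es X)
  (family-foldl (λ Y → trans (family-loopComplement₁ D (suc e) (x ∷ Y))
    (trans (slice-loop₁ x Y) (sym (family-loopComplement₁ (slice x D) e Y)))) es X)
  where
  slice-loop₁ : ∀ x Y → loop₁ (family D) (suc e) (x ∷ Y) ≡ loop₁ (family D ∘ (x ∷_)) e Y
  slice-loop₁ false Y = refl
  slice-loop₁ true  Y = refl

filter-∈-suc : ∀ a (A : Subset n) es → filter (_∈? (a ∷ A)) (map suc es) ≡ map suc (filter (_∈? A) es)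
filter-∈-suc a A []       = refl
filter-∈-suc a A (e ∷ es) with does (e ∈? A)
... | true  = cong (suc e ∷_) (filter-∈-suc a A es)
... | false = filter-∈-suc a A es

-- The element `zero` is processed first. All later elements are successors, so they act within each
-- slice, and the induction hypothesis applies there; this matches the coordinate recursion of
-- `loop`.
family-loopComplement : ∀ (D : SetSystem n) A → family (loopComplement D A) ≗ loop (family D) A
family-loopComplement D []      []      = refl
family-loopComplement {suc n} D (a ∷ A) (x ∷ X) = trans
  (cong (λ es → family (foldl loopComplement₁ D (filter (_∈? (a ∷ A)) (zero ∷ es))) (x ∷ X))
        (sym (map-tabulate id suc)))
  (go a x)
  where
  rest : ∀ a (D : SetSystem (suc n)) x →
    family (foldl loopComplement₁ D (filter (_∈? (a ∷ A)) (map suc (allFin n)))) (x ∷ X)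
      ≡ loop (family D ∘ (x ∷_)) A X
  rest a D x = trans
    (cong (λ es → family (foldl loopComplement₁ D es) (x ∷ X)) (filter-∈-suc a A (allFin n)))
    (trans (slice-foldl x D (filter (_∈? A) (allFin n)) X) (family-loopComplement (slice x D) A X))
  go : ∀ a x →
    family (foldl loopComplement₁ D (filter (_∈? (a ∷ A)) (zero ∷ map suc (allFin n)))) (x ∷ X)
      ≡ loop (family D) (a ∷ A) (x ∷ X)
  go false x     = rest false D x
  go true  false = trans (rest true (loopComplement₁ D zero) false)
    (loop-cong (λ Y → trans (family-loopComplement₁ D zero (false ∷ Y)) (Bool.xor-identityʳ _)) A X)
  go true  true  = trans (rest true (loopComplement₁ D zero) true)
    (loop-cong (λ Y → trans (family-loopComplement₁ D zero (true ∷ Y))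
      (cong (λ Z → family D (true ∷ Y) xor family D (false ∷ Z)) (△-identityʳ Y))) A X)

-- The operations ∗× and ×∗

-- On indicator functions a twist is precomposition with `_△ A`, and thus the word decides whether
-- it happens inside `loop` or at its argument.
transform : Word → (Subset n → Bool) → Subset n → Subset n → Bool
transform ∗× f A X = loop (λ Y → f (Y △ A)) A X
transform ×∗ f A X = loop f A (X △ A)

family-^ : ∀ (D : SetSystem n) σ A → family (D ^[ σ ∣ A ]) ≗ transform σ (family D) A
family-^ D ∗× A X = trans (family-loopComplement (twist D A) A X)
  (loop-cong (family-twist D A) A X)
family-^ D ×∗ A X = trans (family-twist (loopComplement D A) A X)
  (family-loopComplement D A (X △ A))

transform-cong : ∀ σ {f g : Subset n → Bool} → f ≗ g → ∀ A → transform σ f A ≗ transform σ g A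
transform-cong ∗× f≗g A X = loop-cong (λ Y → f≗g (Y △ A)) A X
transform-cong ×∗ f≗g A X = loop-cong f≗g A (X △ A)

transform-⊥ : ∀ σ (f : Subset n → Bool) → transform σ f ⊥ ≗ f
transform-⊥ ∗× f X = trans (loop-⊥ _ X) (cong f (△-identityʳ X))
transform-⊥ ×∗ f X = trans (loop-⊥ f _) (cong f (△-identityʳ X))

-- By `loop-△` the middle two of the four operations commute, so the twists and the loop
-- complementations can be collected separately.
transform-∪ : ∀ σ (f : Subset n → Bool) {A B} → Disjoint A B →
  transform σ (transform σ f A) B ≗ transform σ f (A ∪ B)
transform-∪ ∗× f {A} {B} A∥B X = begin
  loop (λ Y → loop (λ Z → f (Z △ A)) A (Y △ B)) B X ≡⟨ loop-cong (loop-△ (λ Z → f (Z △ A)) A∥B) B X ⟩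
  loop (loop (λ Z → f (Z △ B △ A)) A) B X            ≡⟨ loop-∪ _ A∥B X ⟩
  loop (λ Z → f (Z △ B △ A)) (A ∪ B) X               ≡⟨ loop-cong (λ Z → cong f (△-∪ A∥B Z)) (A ∪ B) X ⟩
  loop (λ Z → f (Z △ (A ∪ B))) (A ∪ B) X             ∎
  where open ≡-Reasoning
transform-∪ ×∗ f {A} {B} A∥B X = begin
  loop (λ Y → loop f A (Y △ A)) B (X △ B) ≡⟨ loop-△ (loop f A) (λ i∈B i∈A → A∥B i∈A i∈B) (X △ B) ⟨
  loop (loop f A) B (X △ B △ A)           ≡⟨ loop-∪ f A∥B (X △ B △ A) ⟩
  loop f (A ∪ B) (X △ B △ A)              ≡⟨ cong (loop f (A ∪ B)) (△-∪ A∥B X) ⟩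
  loop f (A ∪ B) (X △ (A ∪ B))            ∎
  where open ≡-Reasoning

^-∪ : ∀ (D : SetSystem n) σ {A B} → Disjoint A B → D ^[ σ ∣ A ] ^[ σ ∣ B ] ≈ D ^[ σ ∣ A ∪ B ]
^-∪ D σ {A} {B} A∥B X = begin
  family (D ^[ σ ∣ A ] ^[ σ ∣ B ]) X            ≡⟨ family-^ (D ^[ σ ∣ A ]) σ B X ⟩
  transform σ (family (D ^[ σ ∣ A ])) B X       ≡⟨ transform-cong σ (family-^ D σ A) B X ⟩
  transform σ (transform σ (family D) A) B X    ≡⟨ transform-∪ σ (family D) A∥B X ⟩
  transform σ (family D) (A ∪ B) X              ≡⟨ family-^ D σ (A ∪ B) X ⟨
  family (D ^[ σ ∣ A ∪ B ]) X                   ∎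
  where open ≡-Reasoning

^-⊥ : ∀ (D : SetSystem n) σ → D ^[ σ ∣ ⊥ ] ≈ D
^-⊥ D σ X = trans (family-^ D σ ⊥ X) (transform-⊥ σ (family D) X)

^-local : ∀ (D : SetSystem n) σ A {X} → Feasible (D ^[ σ ∣ A ]) X →
  ∃ λ Y → Feasible D Y × (∀ {i} → i ∉ A → lookup X i ≡ lookup Y i)
^-local D ∗× A {X} X∈ with loop-local _ A X (subst T (family-^ D ∗× A X) X∈)
... | Y , Y△A∈D , X≡Y = Y △ A , Y△A∈D , λ i∉A → trans (X≡Y i∉A) (sym (lookup-△-∉ Y i∉A))
^-local D ×∗ A {X} X∈ with loop-local _ A (X △ A) (subst T (family-^ D ×∗ A X) X∈)
... | Y , Y∈D , X△A≡Y = Y , Y∈D , λ i∉A → trans (sym (lookup-△-∉ X i∉A)) (X△A≡Y i∉A)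

-- The operation at a single element

selects : Word → Fin n → Subset n → Bool
selects ∗× e X = lookup X e
selects ×∗ e X = not (lookup X e)

selects-flip : ∀ σ e (X : Subset n) → selects σ e (X △ ⁅ e ⁆) ≡ not (selects σ e X)
selects-flip ∗× e X = lookup-△-⁅⁆ X e
selects-flip ×∗ e X = cong not (lookup-△-⁅⁆ X e)

-- On a pair X, `X △ ⁅ e ⁆` the two values are swapped, and one of the two sets receives their sum
-- instead. The words differ only in which one, and `selects` records this.
family-^-⁅⁆ : ∀ (D : SetSystem n) σ e X →
  family (D ^[ σ ∣ ⁅ e ⁆ ]) X ≡ family D (X △ ⁅ e ⁆) xor (selects σ e X ∧ family D X)
family-^-⁅⁆ D ∗× e X = trans (family-^ D ∗× ⁅ e ⁆ X) (trans (loop-⁅⁆ _ e X)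
  (cong (λ Y → family D (X △ ⁅ e ⁆) xor (lookup X e ∧ family D Y)) (△-cancelʳ X ⁅ e ⁆)))
family-^-⁅⁆ D ×∗ e X = trans (family-^ D ×∗ ⁅ e ⁆ X) (trans (loop-⁅⁆ _ e (X △ ⁅ e ⁆))
  (cong₂ (λ b Y → family D (X △ ⁅ e ⁆) xor (b ∧ family D Y)) (lookup-△-⁅⁆ X e) (△-cancelʳ X ⁅ e ⁆)))

family-^-⁅⁆-flip : ∀ (D : SetSystem n) σ e X →
  family (D ^[ σ ∣ ⁅ e ⁆ ]) (X △ ⁅ e ⁆) ≡
  family D X xor (not (selects σ e X) ∧ family D (X △ ⁅ e ⁆))
family-^-⁅⁆-flip D σ e X = trans (family-^-⁅⁆ D σ e (X △ ⁅ e ⁆))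
  (cong₂ (λ Y b → family D Y xor (b ∧ family D (X △ ⁅ e ⁆))) (△-cancelʳ X ⁅ e ⁆) (selects-flip σ e X))

module _ (D : SetSystem n) (σ : Word) (e : Fin n) where

  -- For either word the new value at `F △ ⁅ e ⁆` contains the old value at F as a term, and the
  -- only other possible term is false.
  feasible-flip : ∀ {F} → Feasible D F → ¬ Feasible D (F △ ⁅ e ⁆) →
    Feasible (D ^[ σ ∣ ⁅ e ⁆ ]) (F △ ⁅ e ⁆)
  feasible-flip {F} F∈D F△e∉D = subst T (sym (family-^-⁅⁆-flip D σ e F)) (bits _ _ _ F∈D F△e∉D)
    where
    bits : ∀ x y c → T x → ¬ T y → T (x xor (not c ∧ y))
    bits true false true  _ _  = _
    bits true false false _ _  = _
    bits _    true  _     _ ¬y = ⊥-elim (¬y _)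

  -- The values on the pair undergo an invertible linear map over the field with two elements, so
  -- they do not both become false.
  feasible-or-flip : ∀ {F} → Feasible D F →
    Feasible (D ^[ σ ∣ ⁅ e ⁆ ]) F ⊎ Feasible (D ^[ σ ∣ ⁅ e ⁆ ]) (F △ ⁅ e ⁆)
  feasible-or-flip {F} F∈D
    rewrite family-^-⁅⁆ D σ e F | family-^-⁅⁆-flip D σ e F =
    bits (family D F) (family D (F △ ⁅ e ⁆)) (selects σ e F) F∈D
    where
    bits : ∀ x y c → T x → T (y xor (c ∧ x)) ⊎ T (x xor (not c ∧ y))
    bits true _     true  _ = inj₂ _
    bits true false false _ = inj₂ _
    bits true true  false _ = inj₁ _

  private
    Dₑ = D ^[ σ ∣ ⁅ e ⁆ ]

  rmin-^-⁅⁆ : Proper D → rmin Dₑ ≤ suc (rmin D)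
  rmin-^-⁅⁆ D-proper with rmin-attained D D-proper
  ... | F , F∈D , ∣F∣≡rmin with feasible-or-flip F∈D
  ...   | inj₁ F∈   = ℕ.m≤n⇒m≤1+n (ℕ.≤-trans (rmin≤ Dₑ F∈) (ℕ.≤-reflexive ∣F∣≡rmin))
  ...   | inj₂ F△e∈ = ℕ.≤-trans (rmin≤ Dₑ F△e∈)
    (ℕ.≤-trans (∣p△⁅x⁆∣≤ e F) (ℕ.≤-reflexive (cong suc ∣F∣≡rmin)))

  rmax-^-⁅⁆ : rmax D ≤ suc (rmax Dₑ)
  rmax-^-⁅⁆ = rmax≤ D bound
    where
    bound : ∀ F → Feasible D F → ∣ F ∣ ≤ suc (rmax Dₑ)
    bound F F∈D with feasible-or-flip F∈D
    ... | inj₁ F∈   = ℕ.m≤n⇒m≤1+n (≤rmax Dₑ F∈)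
    ... | inj₂ F△e∈ = ℕ.≤-trans (∣p∣≤∣p△⁅x⁆∣ e F) (s≤s (≤rmax Dₑ F△e∈))

  -- If e were in F, then `F △ ⁅ e ⁆` would be too small to be feasible in D, hence feasible in
  -- `Dₑ`. The minimum would drop by at least one while the maximum drops by at most one, so the
  -- width could not decrease.
  smallest-avoids : ω Dₑ < ω D → ∀ {F} → Feasible D F → ∣ F ∣ ≡ rmin D → e ∉ F
  smallest-avoids decreases {F} F∈D ∣F∣≡rmin e∈F = ℕ.<⇒≱ decreases
    -- Both bounds carry a `suc`, and these cancel by reduction of `_∸_`, leaving `ω Dₑ`.
    (ℕ.∸-mono rmax-^-⁅⁆ (ℕ.≤-trans (s≤s (rmin≤ Dₑ (feasible-flip F∈D F△e∉D))) (ℕ.≤-reflexive size)))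
    where
    size : suc ∣ F △ ⁅ e ⁆ ∣ ≡ rmin D
    size = trans (∣p△⁅x⁆∣-∈ e∈F) ∣F∣≡rmin
    F△e∉D : ¬ Feasible D (F △ ⁅ e ⁆)
    F△e∉D F△e∈D = ℕ.<⇒≱ (ℕ.≤-reflexive size) (rmin≤ D F△e∈D)

  largest-contains : Proper D → ω Dₑ < ω D → ∀ {F} → Feasible D F → ∣ F ∣ ≡ rmax D → e ∈ F
  largest-contains D-proper decreases {F} F∈D ∣F∣≡rmax with e ∈? F
  ... | yes e∈F = e∈F
  ... | no  e∉F = contradiction
    (ℕ.∸-mono (ℕ.≤-trans (ℕ.≤-reflexive (sym size)) (≤rmax Dₑ (feasible-flip F∈D F△e∉D)))
              (rmin-^-⁅⁆ D-proper))
    (ℕ.<⇒≱ decreases)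
    where
    size : ∣ F △ ⁅ e ⁆ ∣ ≡ suc (rmax D)
    size = trans (∣p△⁅x⁆∣-∉ e∉F) (cong suc ∣F∣≡rmax)
    F△e∉D : ¬ Feasible D (F △ ⁅ e ⁆)
    F△e∉D F△e∈D = ℕ.<⇒≱ (ℕ.≤-reflexive (sym size)) (≤rmax D F△e∈D)

-- Sets whose elements all decrease the width

vfSafe-^ : {D : SetSystem n} → VfSafe D → ∀ σ A → VfSafe (D ^[ σ ∣ A ])
vfSafe-^ safe ∗× A ops = safe (twistOn A ∷ loopComplementOn A ∷ ops)
vfSafe-^ safe ×∗ A ops = safe (loopComplementOn A ∷ twistOn A ∷ ops)

module _ {D : SetSystem n} (safe : VfSafe D) (σ : Word) where

  -- Let X be feasible in `Dᴬ` and agree with Z outside A. A largest feasible F above Z contains all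
  -- of A, so it contains X; a smallest feasible F below Z misses A, so it lies inside X.
  ω-^-stuck : ∀ A → (∀ {e} → e ∈ A → ω (D ^[ σ ∣ ⁅ e ⁆ ]) < ω D) → ω (D ^[ σ ∣ A ]) ≤ ω D
  ω-^-stuck A decreases = ℕ.∸-mono
    (rmax≤ Dᴬ upper)
    (≤rmin Dᴬ (ℕ.≤-trans (rmin≤ D (proj₂ D-proper)) (∣p∣≤n (proj₁ D-proper))) lower)
    where
    Dᴬ = D ^[ σ ∣ A ]
    D-proper = IsDeltaMatroid.proper (safe [])
    upper : ∀ X → Feasible Dᴬ X → ∣ X ∣ ≤ rmax D
    upper X X∈ with ^-local D σ A X∈
    ... | Z , Z∈D , X≡Z with contained-in-largest (safe (twistOn ⊤ ∷ [])) Z∈D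
    ...   | F , F∈D , ∣F∣≡rmax , Z⊆F = subst (∣ X ∣ ≤_) ∣F∣≡rmax (p⊆q⇒∣p∣≤∣q∣ X⊆F)
      where
      X⊆F : X ⊆ F
      X⊆F {i} i∈X with i ∈? A
      ... | yes i∈A = largest-contains D σ i D-proper (decreases i∈A) F∈D ∣F∣≡rmax
      ... | no  i∉A = Z⊆F (lookup⇒[]= i Z (trans (sym (X≡Z i∉A)) ([]=⇒lookup i∈X)))
    lower : ∀ X → Feasible Dᴬ X → rmin D ≤ ∣ X ∣
    lower X X∈ with ^-local D σ A X∈
    ... | Z , Z∈D , X≡Z with contains-smallest (safe []) Z∈D
    ...   | F , F∈D , ∣F∣≡rmin , F⊆Z = subst (_≤ ∣ X ∣) ∣F∣≡rmin (p⊆q⇒∣p∣≤∣q∣ F⊆X)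
      where
      F⊆X : F ⊆ X
      F⊆X {i} i∈F = lookup⇒[]= i X (trans (X≡Z i∉A) ([]=⇒lookup (F⊆Z i∈F)))
        where
        i∉A : i ∉ A
        i∉A i∈A = smallest-avoids D σ i (decreases i∈A) F∈D ∣F∣≡rmin i∈F

-- Orderings and the widths of their prefixes

∈-fromList⁺ : ∀ {e} {es : List (Fin n)} → e List.∈ es → e ∈ fromList es
∈-fromList⁺ {e = e} (here refl) = x∈p∪q⁺ (inj₁ (x∈⁅x⁆ e))
∈-fromList⁺         (there e∈)  = x∈p∪q⁺ (inj₂ (∈-fromList⁺ e∈))

∈-fromList⁻ : ∀ {e} (es : List (Fin n)) → e ∈ fromList es → e List.∈ es
∈-fromList⁻ []       e∈ = contradiction e∈ ∉⊥
∈-fromList⁻ (x ∷ es) e∈ with x∈p∪q⁻ ⁅ x ⁆ (fromList es) e∈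
... | inj₁ e∈⁅x⁆ = here (x∈⁅y⁆⇒x≡y x e∈⁅x⁆)
... | inj₂ e∈es  = there (∈-fromList⁻ es e∈es)

-- Agreement is demanded only for lists with entries from `xs`, because `prefixWidths-∷` can compare
-- widths only on prefixes avoiding `e`.
map-inits-cong : ∀ {A B : Set} (g h : List A → B) xs →
  (∀ ys → (∀ {x} → x List.∈ ys → x List.∈ xs) → g ys ≡ h ys) →
  map g (drop 1 (inits xs)) ≡ map h (drop 1 (inits xs))
map-inits-cong g h []       g≡h = refl
map-inits-cong g h (x ∷ xs) g≡h = cong₂ _∷_
  (g≡h (x ∷ []) λ { (here refl) → here refl })
  (trans (sym (map-∘ (drop 1 (inits xs))))
  (trans (map-inits-cong (g ∘ (x ∷_)) (h ∘ (x ∷_)) xs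
    λ ys ys⊆xs → g≡h (x ∷ ys) λ { (here refl) → here refl ; (there y∈) → there (ys⊆xs y∈) })
  (map-∘ (drop 1 (inits xs)))))

-- Performing the operation at `e` first turns each longer prefix into a prefix of `es` for the new
-- system, by `^-∪`. This allows induction on the path with a changing D.
prefixWidths-∷ : ∀ (D : SetSystem n) σ e es → e List.∉ es →
  prefixWidths D σ (e ∷ es) ≡ ω D ∷ prefixWidths (D ^[ σ ∣ ⁅ e ⁆ ]) σ es
prefixWidths-∷ D σ e es e∉es = cong (ω D ∷_) (cong₂ _∷_
  (cong (λ A → ω (D ^[ σ ∣ A ])) (∪-identityʳ ⁅ e ⁆))
  (trans (sym (map-∘ (drop 1 (inits es))))
    (map-inits-cong _ _ es λ p p⊆es →
      sym (ω-cong (^-∪ D σ (x∉p⇒⁅x⁆-disjoint (e∉es ∘ p⊆es ∘ ∈-fromList⁻ p)))))))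

-- Here `k` is fuel bounding the size of A. A step at `e` passes to `D ^[ σ ∣ ⁅ e ⁆ ]`, again
-- vf-safe, and to `A - e`. The path may stop before exhausting A, but only where the rest of A
-- gains no width.
nondecreasing-path : ∀ k {D : SetSystem n} → VfSafe D → ∀ σ A → ∣ A ∣ < k →
  ∃ λ es → Unique es × fromList es ⊆ A ×
    ω (D ^[ σ ∣ A ]) ≤ ω (D ^[ σ ∣ fromList es ]) × Linked _≤_ (prefixWidths D σ es)
nondecreasing-path (suc k) {D} safe σ A (s≤s ∣A∣≤k)
  with Fin.any? (λ e → (e ∈? A) ×-dec (ω D ≤? ω (D ^[ σ ∣ ⁅ e ⁆ ])))
-- Every element of A now strictly decreases the width, so by `ω-^-stuck` the empty ordering is
-- already good enough.
... | no ∄e = [] , [] , ⊥⊆ ,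
  ℕ.≤-trans (ω-^-stuck safe σ A λ e∈A → ℕ.≰⇒> λ ωD≤ → ∄e (_ , e∈A , ωD≤))
            (ℕ.≤-reflexive (sym (ω-cong (^-⊥ D σ)))) ,
  [-]
... | yes (e , e∈A , ωD≤)
  with nondecreasing-path k (vfSafe-^ safe σ ⁅ e ⁆) σ (A - e)
         (ℕ.<-≤-trans (x∈p⇒∣p-x∣<∣p∣ e∈A) ∣A∣≤k)
... | es , unique , es⊆A-e , ω≤ , linked =
  e ∷ es , All.tabulate (λ { x∈es refl → e∉es x∈es }) ∷ unique , e∷es⊆A , ω≤′ ,
  subst (Linked _≤_) (sym (prefixWidths-∷ D σ e es e∉es)) (ωD≤ ∷ linked)
  where
  e∉es : e List.∉ es
  e∉es e∈es = x∉p-x e A (es⊆A-e (∈-fromList⁺ e∈es))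
  e∷es⊆A : fromList (e ∷ es) ⊆ A
  e∷es⊆A i∈ with x∈p∪q⁻ ⁅ e ⁆ (fromList es) i∈
  ... | inj₁ i∈⁅e⁆ = subst (_∈ A) (sym (x∈⁅y⁆⇒x≡y e i∈⁅e⁆)) e∈A
  ... | inj₂ i∈es  = p─q⊆p A ⁅ e ⁆ (es⊆A-e i∈es)
  ω≤′ : ω (D ^[ σ ∣ A ]) ≤ ω (D ^[ σ ∣ fromList (e ∷ es) ])
  ω≤′ = begin
    ω (D ^[ σ ∣ A ])                          ≡⟨ cong (λ B → ω (D ^[ σ ∣ B ])) (⁅x⁆∪[p-x]≡p e∈A) ⟨
    ω (D ^[ σ ∣ ⁅ e ⁆ ∪ (A - e) ])            ≡⟨ ω-cong (^-∪ D σ (x∉p⇒⁅x⁆-disjoint (x∉p-x e A))) ⟨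
    ω (D ^[ σ ∣ ⁅ e ⁆ ] ^[ σ ∣ A - e ])       ≤⟨ ω≤ ⟩
    ω (D ^[ σ ∣ ⁅ e ⁆ ] ^[ σ ∣ fromList es ]) ≡⟨ ω-cong (^-∪ D σ (x∉p⇒⁅x⁆-disjoint (e∉es ∘ ∈-fromList⁻ es))) ⟩
    ω (D ^[ σ ∣ fromList (e ∷ es) ])          ∎
    where open ℕ.≤-Reasoning

theorem4p6 : ∀ {n : ℕ} (D : SetSystem n) → IsDeltaMatroid D → VfSafe D →
    (σ : Word) (S : Subset n) →
    ∃ λ (A : Subset n) → ∃ λ (es : List (Fin n)) →
    A ⊆ S × es IsOrderingOf A ×
    (∀ B → B ⊆ S → ω (D ^[ σ ∣ B ]) ≤ ω (D ^[ σ ∣ A ])) ×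
    Linked _≤_ (prefixWidths D σ es)
theorem4p6 D _ safe σ S with argmaxSubset (λ A → ω (D ^[ σ ∣ A ])) S
... | A , A⊆S , A-max with nondecreasing-path _ safe σ A (ℕ.n<1+n _)
... | es , unique , es⊆A , ωA≤ , linked =
  -- The witness is the set reached by the path, possibly smaller than the maximizer A; its width is
  -- at least that of A and hence also maximal.
  fromList es , es , A⊆S ∘ es⊆A ,
  record { distinct = unique ; elements = λ e → mk⇔ ∈-fromList⁺ (∈-fromList⁻ es) } ,
  (λ B B⊆S → ℕ.≤-trans (A-max B B⊆S) ωA≤) , linked
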